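{- Let $\mathscr{A}\subseteq\{(\mathsf 4),(\mathsf m),(\mathsf J)\}$ and let $\mathbf L=\mathbf K^+\cup\mathscr{A}$ be the corresponding strictly positive logic, with tree rewriting calculus $\mathsf T\mathbf L$. For all strictly positive formulas $\varphi,\psi\in\mathscr L^+$, if $\varphi\vdash_{\mathbf L}\psi$, then $\mathcal T(\varphi)\hookrightarrow^{*}_{\mathsf T\mathbf L}\mathcal T(\psi)$.
   Context: Formulas. Fix a set $\mathsf{Prop}$ of propositional variables. $\mathscr L^+$ is generated by $\varphi::=\top\mid p\mid\langle\alpha\rangle\varphi\mid(\varphi\wedge\varphi)$ with $p\in\mathsf{Prop}$, $\alpha\in\mathbb N$. Sequents are expressions $\varphi\vdash\psi$ with $\varphi,\psi\in\mathscr L^+$. Logics. $\mathbf K^+$ has the axioms and rules: $\varphi\vdash\varphi$; $\varphi\vdash\top$; from $\varphi\vdash\psi$ and $\psi\vdash\phi$ infer $\varphi\vdash\phi$; $\varphi\wedge\psi\vdash\varphi$; $\varphi\wedge\psi\vdash\psi$; from $\varphi\vdash\psi$ and $\varphi\vdash\phi$ infer $\varphi\vdash\psi\wedge\phi$; from $\varphi\vdash\psi$ infer $\langle\alpha\rangle\varphi\vdash\langle\alpha\rangle\psi$. Additional axiom schemes: $(\mathsf 4)$ $\langle\alpha\rangle\langle\alpha\rangle\varphi\vdash\langle\alpha\rangle\varphi$; $(\mathsf m)$ $\langle\alpha\rangle\varphi\vdash\langle\beta\rangle\varphi$ for $\alpha>\beta$; $(\mathsf J)$ $\langle\alpha\rangle\varphi\wedge\langle\beta\rangle\psi\vdash\langle\alpha\rangle(\varphi\wedge\langle\beta\rangle\psi)$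 for $\alpha>\beta$. $\mathbf K^+\cup\mathscr A$ is $\mathbf K^+$ extended with the axioms in $\mathscr A$; $\varphi\vdash_{\mathbf L}\psi$ means the sequent is provable in $\mathbf L$. Trees. $\varnothing$ is the empty list, $\frown$ is list concatenation (a single element is identified with the one-element list), $|L|$ is the length of $L$. The set $\mathsf{Tree}^\diamond$ of modal trees is defined inductively as the set of pairs $\langle\Delta;\Gamma\rangle$ with $\Delta$ a finite list of propositional variables and $\Gamma$ a finite list of pairs $(\alpha,T)$ with $\alpha\in\mathbb N$, $T\in\mathsf{Tree}^\diamond$. Sum: $\langle\Delta_1;\Gamma_1\rangle+\langle\Delta_2;\Gamma_2\rangle:=\langle\Delta_1\frown\Delta_2;\Gamma_1\frown\Gamma_2\rangle$. Positions are strings of positive integers ($\epsilon$ the empty string): for $T=\langle\Delta;[(\alpha_1,S_1),\dots,(\alpha_n,S_n)]\rangle$, $\mathsf{Pos}(T)=\{\epsilon\}\cup\bigcup_{i=1}^n\{i\mathbf k\mid\mathbf k\in\mathsf{Pos}(S_i)\}$. Subtree: $T|_\epsilon=T$, $T|_{i\mathbf r}=S_i|_{\mathbf r}$. Replacement: $T[S]_{\mathbf k}$ is $T$ with the subtree at position $\mathbf k$ replaced by $S$. Embedding $\mathcal T:\mathscr L^+\to\mathsf{Tree}^\diamond$: $\mathcal T(\top)=\langle\varnothing;\varnothing\rangle$, $\mathcal T(p)=\langle[p];\varnothing\rangle$, $\mathcal T(\langle\alpha\rangle\varphi)=\langle\varnothing;[(\alpha,\mathcal T(\varphi))]\rangle$,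 $\mathcal T(\varphi\wedge\psi)=\mathcal T(\varphi)+\mathcal T(\psi)$. Rewriting rules. For $T\in\mathsf{Tree}^\diamond$, $\mathbf k\in\mathsf{Pos}(T)$ and $T|_{\mathbf k}=\langle\Delta;\Gamma\rangle$, a rule rewrites $T$ to $T[S']_{\mathbf k}$, where $S'$ is (all list indices within range): $\rho^+$: $\langle\Delta^{+i};\Gamma\rangle$, where $\Delta^{+i}$ is $\Delta$ with a copy of its $i$-th element prepended; $\rho^-$: $\Delta$ with its $i$-th element removed (same $\Gamma$); $\sigma$: $\Gamma$ with its $i$-th and $j$-th elements swapped, $i\ne j$ (same $\Delta$); $\pi^+$: $\Gamma$ with a copy of its $i$-th element prepended; $\pi^-$: $\Gamma$ with its $i$-th element removed; $\mathsf 4$: if the $i$-th element of $\Gamma$ is $(\beta,\langle\varnothing;[(\beta,S)]\rangle)$, replace it by $(\beta,S)$; $\mathsf m$: if the $i$-th element of $\Gamma$ is $(\alpha,S)$ and $\alpha>\beta$, replace it by $(\beta,S)$; $\mathsf J$: if the $i$-th element of $\Gamma$ is $(\alpha,\langle\tilde\Delta;\tilde\Gamma\rangle)$, the $j$-th element is $(\beta,S)$, $i\neq j$ and $\alpha>\beta$, replace the $i$-th element by $(\alpha,\langle\tilde\Delta;\tilde\Gamma\frown(\beta,S)\rangle)$ and remove the $j$-th element. The calculus $\mathsf T\mathbf L$ for $\mathbf L=\mathbf K^+\cup\mathscr A$ has the rules $\rho^+,\rho^-,\sigma,\pi^+,\pi^-$ together with the rule $\mu$ for each $(\mu)\in\mathscr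 A$. $\hookrightarrow_{\mathsf T\mathbf L}$ is the union of its rules, and $\hookrightarrow^*_{\mathsf T\mathbf L}$ its reflexive transitive closure. -}

module Defs where

open import Data.Fin using (Fin; cast)
open import Data.Fin.Permutation.Components using (transpose)
open import Data.List
  using (List; []; _∷_; [_]; _++_; length; lookup; tabulate; removeAt; _[_]∷=_)
open import Data.List.Properties using (length-∷=)
open import Data.Nat using (ℕ; _>_)
open import Data.Product using (_×_; _,_; proj₁; proj₂)
open import Function using (_∘_)
open import Level using (0ℓ)
open import Relation.Binary.Construct.Closure.ReflexiveTransitive using (Star)
open import Relation.Binary.PropositionalEquality using (_≡_; _≢_; sym)
open import Relation.Unary using (Pred; _∈_)

infixr 7 _∧_
infix 4 _∶_⊢_ _∶_⟶_ _∶_↪_ _∶_↪*_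

data Formula (Var : Set) : Set where
  ⊤    : Formula Var
  var  : Var → Formula Var
  ⟨_⟩_ : ℕ → Formula Var → Formula Var
  _∧_  : Formula Var → Formula Var → Formula Var

data Scheme : Set where
  𝟒 𝐦 𝐉 : Scheme

-- 𝒜 ∶ φ ⊢ ψ: the sequent φ ⊢ ψ is provable in K⁺ ∪ 𝒜.
data _∶_⊢_ {Var : Set} (𝒜 : Pred Scheme 0ℓ) : Formula Var → Formula Var → Set where
  ⊢-refl  : ∀ {φ} → 𝒜 ∶ φ ⊢ φ
  ⊢-⊤     : ∀ {φ} → 𝒜 ∶ φ ⊢ ⊤
  ⊢-trans : ∀ {φ ψ χ} → 𝒜 ∶ φ ⊢ ψ → 𝒜 ∶ ψ ⊢ χ → 𝒜 ∶ φ ⊢ χ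
  ⊢-∧ˡ    : ∀ {φ ψ} → 𝒜 ∶ φ ∧ ψ ⊢ φ
  ⊢-∧ʳ    : ∀ {φ ψ} → 𝒜 ∶ φ ∧ ψ ⊢ ψ
  ⊢-∧     : ∀ {φ ψ χ} → 𝒜 ∶ φ ⊢ ψ → 𝒜 ∶ φ ⊢ χ → 𝒜 ∶ φ ⊢ ψ ∧ χ
  ⊢-⟨⟩    : ∀ {φ ψ} α → 𝒜 ∶ φ ⊢ ψ → 𝒜 ∶ (⟨ α ⟩ φ) ⊢ (⟨ α ⟩ ψ)
  ⊢-𝟒     : ∀ {φ} → 𝟒 ∈ 𝒜 → ∀ α → 𝒜 ∶ (⟨ α ⟩ (⟨ α ⟩ φ)) ⊢ (⟨ α ⟩ φ)
  ⊢-𝐦     : ∀ {φ} → 𝐦 ∈ 𝒜 → ∀ {α β} → α > β → 𝒜 ∶ (⟨ α ⟩ φ) ⊢ (⟨ β ⟩ φ)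
  ⊢-𝐉     : ∀ {φ ψ} → 𝐉 ∈ 𝒜 → ∀ {α β} → α > β →
            𝒜 ∶ (⟨ α ⟩ φ) ∧ (⟨ β ⟩ ψ) ⊢ (⟨ α ⟩ (φ ∧ (⟨ β ⟩ ψ)))

data Tree (Var : Set) : Set where
  ⟪_⨾_⟫ : List Var → List (ℕ × Tree Var) → Tree Var

module _ {Var : Set} where

  infixl 6 _+_

  _+_ : Tree Var → Tree Var → Tree Var
  ⟪ Δ₁ ⨾ Γ₁ ⟫ + ⟪ Δ₂ ⨾ Γ₂ ⟫ = ⟪ Δ₁ ++ Δ₂ ⨾ Γ₁ ++ Γ₂ ⟫

  𝒯 : Formula Var → Tree Var
  𝒯 ⊤         = ⟪ [] ⨾ [] ⟫
  𝒯 (var p)   = ⟪ [ p ] ⨾ [] ⟫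
  𝒯 (⟨ α ⟩ φ) = ⟪ [] ⨾ [ α , 𝒯 φ ] ⟫
  𝒯 (φ ∧ ψ)   = 𝒯 φ + 𝒯 ψ

  -- The elements of Pos T are the strings of child indices that are positions
  -- of T; as usual for Fin, the indices start at 0 rather than 1.
  data Pos : Tree Var → Set where
    ε   : ∀ {T} → Pos T
    _∙_ : ∀ {Δ Γ} (i : Fin (length Γ)) → Pos (proj₂ (lookup Γ i)) → Pos ⟪ Δ ⨾ Γ ⟫

  _∣_ : (T : Tree Var) → Pos T → Tree Var
  T         ∣ ε       = T
  ⟪ Δ ⨾ Γ ⟫ ∣ (i ∙ r) = proj₂ (lookup Γ i) ∣ r

  replace : (T : Tree Var) → Tree Var → Pos T → Tree Var
  replace T         S ε       = S
  replace ⟪ Δ ⨾ Γ ⟫ S (i ∙ r) =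
    ⟪ Δ ⨾ Γ [ i ]∷= (proj₁ (lookup Γ i) , replace (proj₂ (lookup Γ i)) S r) ⟫

swap : {A : Set} (xs : List A) → Fin (length xs) → Fin (length xs) → List A
swap xs i j = tabulate (lookup xs ∘ transpose i j)

-- Both indices refer to the original list; the cast transports j along the
-- equality of lengths, since updating does not change the length.
updateAndRemove : {A : Set} (xs : List A) → Fin (length xs) → A → Fin (length xs) → List A
updateAndRemove xs i x j = removeAt (xs [ i ]∷= x) (cast (sym (length-∷= xs i x)) j)

-- The rules of the calculus for K⁺ ∪ 𝒜, acting at the root.
data _∶_⟶_ {Var : Set} (𝒜 : Pred Scheme 0ℓ) : Tree Var → Tree Var → Set where
  ρ⁺ : ∀ {Δ Γ} (i : Fin (length Δ)) →
       𝒜 ∶ ⟪ Δ ⨾ Γ ⟫ ⟶ ⟪ lookup Δ i ∷ Δ ⨾ Γ ⟫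
  ρ⁻ : ∀ {Δ Γ} (i : Fin (length Δ)) →
       𝒜 ∶ ⟪ Δ ⨾ Γ ⟫ ⟶ ⟪ removeAt Δ i ⨾ Γ ⟫
  σ  : ∀ {Δ Γ} (i j : Fin (length Γ)) → i ≢ j →
       𝒜 ∶ ⟪ Δ ⨾ Γ ⟫ ⟶ ⟪ Δ ⨾ swap Γ i j ⟫
  π⁺ : ∀ {Δ Γ} (i : Fin (length Γ)) →
       𝒜 ∶ ⟪ Δ ⨾ Γ ⟫ ⟶ ⟪ Δ ⨾ lookup Γ i ∷ Γ ⟫
  π⁻ : ∀ {Δ Γ} (i : Fin (length Γ)) →
       𝒜 ∶ ⟪ Δ ⨾ Γ ⟫ ⟶ ⟪ Δ ⨾ removeAt Γ i ⟫
  r𝟒 : ∀ {Δ Γ β S} → 𝟒 ∈ 𝒜 → (i : Fin (length Γ)) →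
       lookup Γ i ≡ (β , ⟪ [] ⨾ [ β , S ] ⟫) →
       𝒜 ∶ ⟪ Δ ⨾ Γ ⟫ ⟶ ⟪ Δ ⨾ Γ [ i ]∷= (β , S) ⟫
  r𝐦 : ∀ {Δ Γ α β S} → 𝐦 ∈ 𝒜 → (i : Fin (length Γ)) →
       lookup Γ i ≡ (α , S) → α > β →
       𝒜 ∶ ⟪ Δ ⨾ Γ ⟫ ⟶ ⟪ Δ ⨾ Γ [ i ]∷= (β , S) ⟫
  r𝐉 : ∀ {Δ Γ α β Δ̃ Γ̃ S} → 𝐉 ∈ 𝒜 → (i j : Fin (length Γ)) →
       lookup Γ i ≡ (α , ⟪ Δ̃ ⨾ Γ̃ ⟫) → lookup Γ j ≡ (β , S) → i ≢ j → α > β →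
       𝒜 ∶ ⟪ Δ ⨾ Γ ⟫ ⟶
         ⟪ Δ ⨾ updateAndRemove Γ i (α , ⟪ Δ̃ ⨾ Γ̃ ++ [ β , S ] ⟫) j ⟫

data _∶_↪_ {Var : Set} (𝒜 : Pred Scheme 0ℓ) (T : Tree Var) : Tree Var → Set where
  at : (k : Pos T) {S′ : Tree Var} → 𝒜 ∶ T ∣ k ⟶ S′ → 𝒜 ∶ T ↪ replace T S′ k

_∶_↪*_ : {Var : Set} → Pred Scheme 0ℓ → Tree Var → Tree Var → Set
𝒜 ∶ T ↪* T′ = Star (𝒜 ∶_↪_) T T′

{-# OPTIONS --safe #-}
-- Because any child of the root can be copied before it is rewritten, φ ⊢ ψ
-- never has to consume its hypothesis.  The proof goes by induction on the
-- derivation of φ ⊢ ψ for the stronger claim that every tree U containing the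
-- root labels and the children of 𝒯 φ rewrites to 𝒯 ψ + U.  This form makes the
-- cut and conjunction rules immediate, without any lemma on rewriting inside
-- a sum, because ρ± and π± turn a tree into any other one whose root labels and
-- children it contains.
module Submission where

open import Defs
open import Data.Fin using (zero; suc)
open import Data.List using (List; []; _∷_; _++_; lookup; removeAt)
open import Data.List.Membership.Propositional using (_∈_)
open import Data.List.Membership.Propositional.Properties using (∈-++⁺ʳ; ∈-++⁻)
open import Data.List.Properties using (++-identityʳ)
open import Data.List.Relation.Binary.Subset.Propositional using (_⊆_)
open import Data.List.Relation.Binary.Subset.Propositional.Properties
  using (⊆-refl; ⊆-trans; xs⊆xs++ys; xs⊆ys++xs)
open import Data.List.Relation.Unary.Any using (here; there; index)
open import Data.List.Relation.Unary.Any.Properties using (lookup-index)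
open import Data.Product using (_,_)
open import Data.Sum using ([_,_]′)
open import Function using (_∘_; id)
open import Level using (0ℓ)
open import Relation.Binary using (Rel)
open import Relation.Binary.Construct.Closure.ReflexiveTransitive
  using (Star; ε; _◅_; _◅◅_; gmap)
open import Relation.Binary.PropositionalEquality using (_≡_; refl; sym; cong; subst)
open import Relation.Unary using (Pred)

module _ {A : Set} where

  ++-⊆ : {xs ys zs : List A} → xs ⊆ zs → ys ⊆ zs → xs ++ ys ⊆ zs
  ++-⊆ {xs} xs⊆zs ys⊆zs = [ xs⊆zs , ys⊆zs ]′ ∘ ∈-++⁻ xs

  removeAt-++ : (xs : List A) {y : A} {ys : List A} →
    removeAt (xs ++ y ∷ ys) (index (∈-++⁺ʳ xs (here {x = y} {xs = ys} refl))) ≡ xs ++ ys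
  removeAt-++ []       = refl
  removeAt-++ (x ∷ xs) = cong (x ∷_) (removeAt-++ xs)

  module _ {R : Rel (List A) 0ℓ}
           (copy : ∀ {xs} i → R xs (lookup xs i ∷ xs))
           (drop : ∀ {xs} i → R xs (removeAt xs i)) where

    copy-∈ : ∀ {x xs} → x ∈ xs → R xs (x ∷ xs)
    copy-∈ {x} {xs} x∈xs =
      subst (λ y → R xs (y ∷ xs)) (sym (lookup-index x∈xs)) (copy (index x∈xs))

    copy-⊆ : ∀ {xs} ys → ys ⊆ xs → Star R xs (ys ++ xs)
    copy-⊆      []       _     = ε
    copy-⊆ {xs} (y ∷ ys) ys⊆xs =
      -- The tail goes first; `y` is then copied from its occurrence in `xs`, behind the new `ys`.
      copy-⊆ ys (ys⊆xs ∘ there) ◅◅ copy-∈ (∈-++⁺ʳ ys (ys⊆xs (here refl))) ◅ ε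

    drop-suffix : ∀ xs ys → Star R (xs ++ ys) xs
    drop-suffix xs []       = subst (λ zs → Star R zs xs) (sym (++-identityʳ xs)) ε
    drop-suffix xs (y ∷ ys) =
      subst (R (xs ++ y ∷ ys)) (removeAt-++ xs) (drop (index (∈-++⁺ʳ xs (here refl))))
        ◅ drop-suffix xs ys

    -- All of `ys` is copied to the front before `xs` is dropped, so order and multiplicity do not
    -- matter. `R` will be a step with `ρ⁺`, `ρ⁻` on labels or with `π⁺`, `π⁻` on children.
    rearrange : ∀ {xs ys} → ys ⊆ xs → Star R xs ys
    rearrange {xs} {ys} ys⊆xs = copy-⊆ ys ys⊆xs ◅◅ drop-suffix ys xs

module _ {Var : Set} where

  infix 4 _⊑_

  -- Matching on a proof exposes both trees as pairs of lists, which lets `_+_` compute.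
  data _⊑_ : Tree Var → Tree Var → Set where
    _,_ : ∀ {Δ₁ Γ₁ Δ₂ Γ₂} → Δ₁ ⊆ Δ₂ → Γ₁ ⊆ Γ₂ → ⟪ Δ₁ ⨾ Γ₁ ⟫ ⊑ ⟪ Δ₂ ⨾ Γ₂ ⟫

  ⊑-refl : ∀ {T} → T ⊑ T
  ⊑-refl {⟪ _ ⨾ _ ⟫} = ⊆-refl , ⊆-refl

  ⊑-trans : ∀ {S T U} → S ⊑ T → T ⊑ U → S ⊑ U
  ⊑-trans (Δ₁ , Γ₁) (Δ₂ , Γ₂) = ⊆-trans Δ₁ Δ₂ , ⊆-trans Γ₁ Γ₂

  ⊑-+ˡ : ∀ S T → S ⊑ S + T
  ⊑-+ˡ ⟪ Δ₁ ⨾ Γ₁ ⟫ ⟪ Δ₂ ⨾ Γ₂ ⟫ = xs⊆xs++ys Δ₁ Δ₂ , xs⊆xs++ys Γ₁ Γ₂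

  ⊑-+ʳ : ∀ S T → T ⊑ S + T
  ⊑-+ʳ ⟪ Δ₁ ⨾ Γ₁ ⟫ ⟪ Δ₂ ⨾ Γ₂ ⟫ = xs⊆ys++xs Δ₂ Δ₁ , xs⊆ys++xs Γ₂ Γ₁

  +-⊑ : ∀ {S T U} → S ⊑ U → T ⊑ U → S + T ⊑ U
  +-⊑ (Δ₁ , Γ₁) (Δ₂ , Γ₂) = ++-⊆ Δ₁ Δ₂ , ++-⊆ Γ₁ Γ₂

  module _ {𝒜 : Pred Scheme 0ℓ} where

    ⊑⇒↪* : ∀ {S T} → S ⊑ T → 𝒜 ∶ T ↪* S
    ⊑⇒↪* {⟪ Δ₁ ⨾ Γ₁ ⟫} {⟪ Δ₂ ⨾ Γ₂ ⟫} (Δ₁⊆Δ₂ , Γ₁⊆Γ₂) =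
      gmap ⟪_⨾ Γ₂ ⟫ id
        (rearrange {R = λ Δ Δ′ → 𝒜 ∶ ⟪ Δ ⨾ Γ₂ ⟫ ↪ ⟪ Δ′ ⨾ Γ₂ ⟫}
          (λ i → at ε (ρ⁺ i)) (λ i → at ε (ρ⁻ i)) Δ₁⊆Δ₂)
      ◅◅
      gmap ⟪ Δ₁ ⨾_⟫ id
        (rearrange {R = λ Γ Γ′ → 𝒜 ∶ ⟪ Δ₁ ⨾ Γ ⟫ ↪ ⟪ Δ₁ ⨾ Γ′ ⟫}
          (λ i → at ε (π⁺ i)) (λ i → at ε (π⁻ i)) Γ₁⊆Γ₂)

    copy-child : ∀ {Δ Γ c} → c ∈ Γ → 𝒜 ∶ ⟪ Δ ⨾ Γ ⟫ ↪* ⟪ Δ ⨾ c ∷ Γ ⟫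
    copy-child c∈Γ = ⊑⇒↪* (⊆-refl , λ { (here refl) → c∈Γ ; (there d∈Γ) → d∈Γ })

    -- A step at `k` in the first child is a step at `zero ∙ k`. The first child is enough, since
    -- `copy-child` puts the copy to be rewritten there.
    ↪*-child : ∀ {Δ Γ α} {S T : Tree Var} → 𝒜 ∶ S ↪* T → 𝒜 ∶ ⟪ Δ ⨾ (α , S) ∷ Γ ⟫ ↪* ⟪ Δ ⨾ (α , T) ∷ Γ ⟫
    ↪*-child {Δ} {Γ} {α} =
      gmap (λ S → ⟪ Δ ⨾ (α , S) ∷ Γ ⟫) λ { (at k step) → at (zero ∙ k) step }

  infix 4 _∶_⇛_

  _∶_⇛_ : Pred Scheme 0ℓ → Tree Var → Tree Var → Set
  𝒜 ∶ T ⇛ S = ∀ {U} → T ⊑ U → 𝒜 ∶ U ↪* S + U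

  module _ {𝒜 : Pred Scheme 0ℓ} where

    ⇛⇒↪* : ∀ {T S} → 𝒜 ∶ T ⇛ S → 𝒜 ∶ T ↪* S
    ⇛⇒↪* {T} {S} T⇛S = T⇛S ⊑-refl ◅◅ ⊑⇒↪* (⊑-+ˡ S T)

    ⊑⇒⇛ : ∀ {S T} → S ⊑ T → 𝒜 ∶ T ⇛ S
    ⊑⇒⇛ S⊑T T⊑U = ⊑⇒↪* (+-⊑ (⊑-trans S⊑T T⊑U) ⊑-refl)

    ⇛-trans : ∀ {T S R} → 𝒜 ∶ T ⇛ S → 𝒜 ∶ S ⇛ R → 𝒜 ∶ T ⇛ R
    ⇛-trans {T} {S} {R} T⇛S S⇛R {U} T⊑U =
      -- The cut tree `S` survives in `R + (S + U)` until the final rearrangement discards it.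
      T⇛S T⊑U ◅◅ S⇛R (⊑-+ˡ S U) ◅◅
      ⊑⇒↪* (+-⊑ (⊑-+ˡ R _) (⊑-trans (⊑-+ʳ S U) (⊑-+ʳ R _)))

    ⇛-+ : ∀ {T S R} → 𝒜 ∶ T ⇛ S → 𝒜 ∶ T ⇛ R → 𝒜 ∶ T ⇛ S + R
    ⇛-+ {T} {S} {R} T⇛S T⇛R {U} T⊑U =
      T⇛S T⊑U ◅◅ T⇛R (⊑-trans T⊑U (⊑-+ʳ S U)) ◅◅
      ⊑⇒↪* (+-⊑ (+-⊑ (⊑-trans (⊑-+ˡ S U) (⊑-+ʳ R _)) (⊑-+ˡ R _))
                (⊑-trans (⊑-+ʳ S U) (⊑-+ʳ R _)))

    ⊢⇒⇛ : ∀ {φ ψ} → 𝒜 ∶ φ ⊢ ψ → 𝒜 ∶ 𝒯 φ ⇛ 𝒯 ψ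
    ⊢⇒⇛ ⊢-refl            = ⊑⇒⇛ ⊑-refl
    ⊢⇒⇛ {φ} ⊢-⊤           = ⊑⇒⇛ (⊤⊑ (𝒯 φ))
      where
      ⊤⊑ : ∀ T → 𝒯 ⊤ ⊑ T
      ⊤⊑ ⟪ _ ⨾ _ ⟫ = (λ ()) , (λ ())
    ⊢⇒⇛ (⊢-trans d e)     = ⇛-trans (⊢⇒⇛ d) (⊢⇒⇛ e)
    ⊢⇒⇛ {φ ∧ ψ} ⊢-∧ˡ      = ⊑⇒⇛ (⊑-+ˡ (𝒯 φ) (𝒯 ψ))
    ⊢⇒⇛ {φ ∧ ψ} ⊢-∧ʳ      = ⊑⇒⇛ (⊑-+ʳ (𝒯 φ) (𝒯 ψ))
    ⊢⇒⇛ (⊢-∧ d e)         = ⇛-+ (⊢⇒⇛ d) (⊢⇒⇛ e)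
    ⊢⇒⇛ (⊢-⟨⟩ {φ} {ψ} α d) (_ , c) =
      -- The original child stays in `U`; only its copy in front is rewritten, by the induction
      -- hypothesis taken at `𝒯 φ` itself.
      copy-child (c (here refl)) ◅◅ ↪*-child (⇛⇒↪* {𝒯 φ} {𝒯 ψ} (⊢⇒⇛ d))
    ⊢⇒⇛ (⊢-𝟒 𝟒∈𝒜 α) (_ , c) =
      copy-child (c (here refl)) ◅◅ at ε (r𝟒 𝟒∈𝒜 zero refl) ◅ ε
    ⊢⇒⇛ (⊢-𝐦 𝐦∈𝒜 α>β) (_ , c) =
      copy-child (c (here refl)) ◅◅ at ε (r𝐦 𝐦∈𝒜 zero refl α>β) ◅ ε
    ⊢⇒⇛ {(⟨ α ⟩ φ) ∧ (⟨ β ⟩ ψ)} (⊢-𝐉 𝐉∈𝒜 α>β) (_ , c) with 𝒯 φ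
    ... | ⟪ Δ ⨾ Γ ⟫ =
      -- The `β` child is copied first, so the copies stand at index 0 (`α`) and 1 (`β`). `r𝐉`
      -- consumes these copies and the originals remain.
      copy-child (c (there (here refl))) ◅◅
      copy-child (there (c (here refl))) ◅◅
      at ε (r𝐉 𝐉∈𝒜 zero (suc zero) refl refl (λ ()) α>β) ◅
      -- The rule leaves the labels `Δ`, whereas `𝒯 (φ ∧ (⟨ β ⟩ ψ))` has `Δ ++ []`.
      ↪*-child (⊑⇒↪* (++-⊆ ⊆-refl (λ ()) , ⊆-refl))

theorem4p8 : (Var : Set) (𝒜 : Pred Scheme 0ℓ) (φ ψ : Formula Var) →
    𝒜 ∶ φ ⊢ ψ → 𝒜 ∶ 𝒯 φ ↪* 𝒯 ψ
theorem4p8 Var 𝒜 φ ψ φ⊢ψ = ⇛⇒↪* {T = 𝒯 φ} {S = 𝒯 ψ} (⊢⇒⇛ φ⊢ψ)
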